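{- Let $M,N\in\mathrm{pSh}(\Omega,L)$, $\bar a\in{}^{\mathrm{lh}(\bar a)}|M|$, $\bar b\in{}^{\mathrm{lh}(\bar a)}|N|$ with $E\bar b=E\bar a$, and let $\alpha$ be an ordinal. The following are equivalent: (1) $[\phi^\alpha_{M,\bar a}(\bar b)]_N=[\phi^\alpha_{N,\bar b}(\bar b)]_N$; (2) $F^\alpha_{M,\bar a}=F^\alpha_{N,\bar b}$.
   Context: **Presheaves.** Fix a complete Heyting algebra $\Omega$ (bottom $\bot$, top $\top$); $x\leftrightarrow y$ means $(x\to y)\wedge(y\to x)$. A presheaf $M$ over $\Omega$ is a set $|M|$ of sections with maps $E:|M|\to\Omega$ (extent) and $\upharpoonright:|M|\times\Omega\to|M|$ (restriction) such that $a\upharpoonright Ea=a$, $E(a\upharpoonright p)=Ea\wedge p$, $(a\upharpoonright p)\upharpoonright q=a\upharpoonright(p\wedge q)$. Put $[a=b]_M=\bigvee\{p\le Ea\wedge Eb: a\upharpoonright p=b\upharpoonright p\}$; presheaves are extensional: $Ea=Eb=[a=b]_M$ implies $a=b$. For a tuple $\bar a=\langle a_i:i<\gamma\rangle$ of sections, $\mathrm{lh}(\bar a)=\gamma$, $E\bar a=\bigwedge_iEa_i$ ($E\emptyset=\top$), $\bar a\upharpoonright p=\langle a_i\upharpoonright p\rangle_i$, $[\bar a=\bar b]_M=\bigwedge_i[a_i=b_i]_M$; $\bar a\bar c$ is the concatenation of $\bar a$ and $\bar c$. ${}^{\gamma}X$ (${}^{<\mu}X$) is the set of tuples from $X$ of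 length $\gamma$ (less than $\mu$). **Structures.** A signature has finitary relation symbols, finitary function symbols and a set of constant symbols, each constant symbol $c$ having extent $Ec=\top$. An element $M$ of $\mathrm{pSh}(\Omega,L)$ is a presheaf with: for each $n$-ary $R$ a map $R^M:|M|^n\to\Omega$ with $R^M(\bar a)\le E\bar a$ and $[\bar a=\bar b]_M\wedge R^M(\bar a)\le R^M(\bar b)$; for each $n$-ary $f$ a map $f^M:|M|^n\to|M|$ with $Ef^M(\bar a)=E\bar a$ and $[\bar a=\bar b]_M\le[f^M(\bar a)=f^M(\bar b)]_M$; for each constant $c$ a section $\mathfrak c^M$ with $E\mathfrak c^M=\top$. **Formulae.** $L$ is first order logic $\bar L_{\omega\omega}$ ($\lambda=\omega,\mu=2$), or $\bar L_{\infty\omega}$ ($\lambda=\omega,\mu=2$), or $L_{\infty\lambda}$ for a cardinal $\lambda$ ($\mu=\lambda$); variables are $v_i$, $i<\lambda$. Unnested atomic formulae are $v_i=v_j$, $v_i=c$, $R(v_{i_0},\dots,v_{i_{n-1}})$, $v_{i_n}=f(v_{i_0},\dots,v_{i_{n-1}})$. The formulae $\phi^\alpha$ used below are built from these by conjunction $\bigwedge$, existential quantification over fewer than $\mu$ variables, and unary connectives $\square_p$ ($p\in\Omega$). Interpretation: for unnested atomic $\psi$, $[\psi(\bar x)]_M$ is $E\bar x$ met with, respectively, $[x_i=x_j]_M$, $[x_i=\mathfrak c^M]_M$, $R^M(x_{i_0},\dots)$, $[x_{i_n}=f^M(x_{i_0},\dots)]_M$; $[\bigwedge\Phi(\bar a)]_M=E\bar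 a\wedge\bigwedge_{\psi\in\Phi}[\psi(\bar a)]_M$; $[\exists\bar u\,\psi(\bar a,\bar u)]_M=E\bar a\wedge\bigvee_{\bar c}[\psi(\bar a,\bar c)]_M$, $\bar c$ ranging over tuples from $|M|$ of the length of $\bar u$; $[\square_p\psi(\bar a)]_M=E\bar a\wedge(p\leftrightarrow[\psi(\bar a)]_M)$. **Functions $F^\alpha_{M,\bar a}$** (values in $\Omega$). $F^0_{M,\bar a}=I_{M,\bar a}$, where $I_{M,\bar a}$ has as domain all $(\psi,f)$ with $\psi$ an unnested atomic formula whose variables are exactly $v_0,\dots,v_{n-1}$ for some $n\in\omega$, and $f:\{0,\dots,n-1\}\to\mathrm{lh}(\bar a)$, and $I_{M,\bar a}(\psi,f)=[\psi(a_{f(0)},\dots,a_{f(n-1)})]_M$. At limits take unions. $F^{\alpha+1}_{M,\bar a}$ extends $F^\alpha_{M,\bar a}$ by new arguments $(F^\alpha_{K,\bar s\bar t},\alpha)$ where $K\in\mathrm{pSh}(\Omega,L)$, $\bar s\in{}^{\mathrm{lh}(\bar a)}|K|$, $\bar t\in{}^{<\mu}|K|$ and $E\bar t\le E\bar a\wedge E\bar s$, with value $\bigvee\{E\bar c:\bar c\in{}^{\mathrm{lh}(\bar t)}|M|,\ E\bar c\le E\bar t,\ F^\alpha_{K,(\bar s\bar t)\upharpoonright E\bar c}=F^\alpha_{M,\bar a\bar c}\}$. **Formulae $\phi^\alpha_{M,\bar a}$**, in free variables $\bar v$ with $\mathrm{lh}(\bar v)=\mathrm{lh}(\bar a)$: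 $\phi^0_{M,\bar a}=\bigwedge_\psi\square_{[\psi(\bar a)]_M}\psi(\bar v)$ over unnested atomic $\psi$; $\phi^\alpha_{M,\bar a}=\bigwedge_{\beta<\alpha}\phi^\beta_{M,\bar a}$ for limit $\alpha$; and $\phi^{\alpha+1}_{M,\bar a}=\phi^\alpha_{M,\bar a}\wedge\bigwedge_{K,\bar s\bar t}\square_{p_{K,\bar s\bar t}}\exists\bar u\,\phi^\alpha_{K,\bar s\bar t}(\bar v,\bar u)$, where $p_{K,\bar s\bar t}=[\exists\bar u\,\phi^\alpha_{K,\bar s\bar t}(\bar a,\bar u)]_M$, the conjunction is over $K\in\mathrm{pSh}(\Omega,L)$, $\bar s\in{}^{\mathrm{lh}(\bar a)}|K|$, $\bar t\in{}^{<\mu}|K|$, and $\bar u$ has length $\mathrm{lh}(\bar t)$.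
   Formalization: The value I_{M,ā}(ψ,f) is taken as [ψ(a_{f(0)},…,a_{f(n-1)})]_M met with the extent Eā of the whole tuple; bounded only by the extents of the selected sections, the claim fails already at α=0, e.g. for ā=(a,a↾p), b̄=(a↾p,a↾p) with Ea=⊤, p<⊤. -}

module Defs where

open import Level using (Level; Setω; Lift; lift; suc; _⊔_)
open import Data.Bool.Base using (Bool; true; false)
open import Data.Fin.Base using (Fin)
open import Data.List.Base using (List; []; _∷_)
open import Data.List.Membership.Propositional using (_∈_)
open import Data.Nat.Base using (ℕ)
open import Data.Product.Base using (Σ; _×_; _,_; proj₁; proj₂; ∃)
open import Data.Refinement.Base using (Refinement)
open import Data.Sum.Base using (_⊎_; inj₁; inj₂; [_,_]′)
open import Data.Vec.Base as Vec using (Vec; lookup; toList)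
open import Function.Bundles using (_↔_)
open import Induction.WellFounded using (WellFounded; Acc; acc)
open import Relation.Binary.Bundles using (Setoid)
open import Relation.Binary.Core using (Rel)
open import Relation.Binary.Definitions using (Trichotomous; tri<; tri≈; tri>)
open import Relation.Binary.Lattice.Bundles using (HeytingAlgebra)
open import Relation.Binary.PropositionalEquality
  using (_≡_; refl; isEquivalence)
open import Relation.Binary.Structures using (IsStrictTotalOrder)
open import Relation.Binary.Structures.Biased using (isStrictTotalOrderᶜ)
open import Relation.Nullary.Negation.Core using (¬_)

------------------------------------------------------------------------
-- Sets are the types (setoids) in Set ℓ, for one fixed ℓ, so that the
-- class of all structures lives in Set (suc ℓ).

-- Joins exist for families of any size.  Families indexed by, or selected
-- by a condition quantifying over, the class of all structures do occur;
-- by separation they range over subsets of Ω, but predicatively their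
-- index types need not be in Set ℓ.

record CompleteHeytingAlgebra (ℓ : Level) : Setω where
  field
    heytingAlgebra : HeytingAlgebra ℓ ℓ ℓ

  open HeytingAlgebra heytingAlgebra public

  field
    ⋁       : ∀ {i} {I : Set i} → (I → Carrier) → Carrier
    ⋁-upper : ∀ {i} {I : Set i} (x : I → Carrier) k → x k ≤ ⋁ x
    ⋁-least : ∀ {i} {I : Set i} (x : I → Carrier) y →
              (∀ k → x k ≤ y) → ⋁ x ≤ y

  ⋀ : ∀ {i} {I : Set i} → (I → Carrier) → Carrier
  ⋀ {I = I} x = ⋁ {I = Σ Carrier λ y → ∀ k → y ≤ x k} proj₁

  infix 5 _⇿_
  _⇿_ : Carrier → Carrier → Carrier
  x ⇿ y = (x ⇨ y) ∧ (y ⇨ x)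

------------------------------------------------------------------------
-- Ordinals are well-ordered sets.  As with von Neumann ordinals, the
-- elements of a well-ordered set W serve as ordinals themselves, x being
-- the order type of the set of its predecessors; every ordinal is of this
-- form (α is the last element of α + 1).

-- Classically every element of a well-order has a kind.

data Kind {ℓ} {A : Set ℓ} (_<_ : Rel A ℓ) (x : A) : Set ℓ where
  least     : (∀ y → ¬ (y < x)) → Kind _<_ x
  successor : ∀ y → y < x → (∀ z → z < x → z ≡ y ⊎ z < y) → Kind _<_ x
  limit     : ∃ (λ y → y < x) →
              (∀ y → y < x → ∃ λ z → y < z × z < x) → Kind _<_ x

record Ordinal (ℓ : Level) : Set (suc ℓ) where
  infix 4 _<_
  field
    Carrier            : Set ℓ
    _<_                : Rel Carrier ℓ
    isStrictTotalOrder : IsStrictTotalOrder _≡_ _<_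
    wellFounded        : WellFounded _<_
    kind               : ∀ x → Kind _<_ x

  -- The ordinal x as a set of indices.
  ↓_ : Carrier → Set ℓ
  ↓ x = Refinement Carrier (_< x)

-- Cardinals are initial ordinals.

record Cardinal (ℓ : Level) : Set (suc ℓ) where
  field
    ordinal : Ordinal ℓ

  open Ordinal ordinal

  field
    initial : ∀ x → ¬ ((↓ x) ↔ Carrier)

data Two {ℓ} : Set ℓ where
  0₂ 1₂ : Two

data _<₂_ {ℓ} : Rel (Two {ℓ}) ℓ where
  0<1 : 0₂ <₂ 1₂

𝟚 : ∀ ℓ → Ordinal ℓ
𝟚 ℓ = record
  { Carrier            = Two
  ; _<_                = _<₂_
  ; isStrictTotalOrder = isStrictTotalOrderᶜ record
      { isEquivalence = isEquivalence
      ; trans         = λ { 0<1 () }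
      ; compare       = compare
      }
  ; wellFounded        = λ { 0₂ → acc₀ ; 1₂ → acc λ { 0<1 → acc₀ } }
  ; kind               = λ
      { 0₂ → least λ _ ()
      ; 1₂ → successor 0₂ 0<1 λ { _ 0<1 → inj₁ refl }
      }
  }
  where
  compare : Trichotomous {A = Two {ℓ}} _≡_ _<₂_
  compare 0₂ 0₂ = tri≈ (λ ()) refl (λ ())
  compare 0₂ 1₂ = tri< 0<1 (λ ()) (λ ())
  compare 1₂ 0₂ = tri> (λ ()) (λ ()) 0<1
  compare 1₂ 1₂ = tri≈ (λ ()) refl (λ ())

  acc₀ : Acc {A = Two {ℓ}} _<₂_ 0₂
  acc₀ = acc λ ()

------------------------------------------------------------------------
-- The logics differ, as far as the formulae below are concerned, in the
-- bound μ on the length of quantified tuples.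

data Logic (ℓ : Level) : Set (suc ℓ) where
  L̄ωω : Logic ℓ
  L̄∞ω : Logic ℓ
  L∞  : Cardinal ℓ → Logic ℓ

μ : ∀ {ℓ} → Logic ℓ → Ordinal ℓ
μ L̄ωω    = 𝟚 _
μ L̄∞ω    = 𝟚 _
μ (L∞ λ′) = Cardinal.ordinal λ′

record Signature (ℓ : Level) : Set (suc ℓ) where
  field
    RelSym   : Set ℓ
    relArity : RelSym → ℕ
    FunSym   : Set ℓ
    funArity : FunSym → ℕ
    ConSym   : Set ℓ

------------------------------------------------------------------------
-- Presheaves; a tuple of sections indexed by I is a function on I.

record Presheaf {ℓ} (Ω : CompleteHeytingAlgebra ℓ) : Set (suc ℓ) where
  private module Ω = CompleteHeytingAlgebra Ω
  infixl 8 _↾_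
  field
    sections : Setoid ℓ ℓ

  open Setoid sections using (_≈_) renaming (Carrier to Section) public

  field
    E      : Section → Ω.Carrier
    _↾_    : Section → Ω.Carrier → Section
    E-cong : ∀ {a b} → a ≈ b → E a Ω.≈ E b
    ↾-cong : ∀ {a b p q} → a ≈ b → p Ω.≈ q → a ↾ p ≈ b ↾ q
    ↾-E    : ∀ a → a ↾ E a ≈ a
    E-↾    : ∀ a p → E (a ↾ p) Ω.≈ E a Ω.∧ p
    ↾-↾    : ∀ a p q → a ↾ p ↾ q ≈ a ↾ (p Ω.∧ q)

  ⟦_≐_⟧ : Section → Section → Ω.Carrier
  ⟦ a ≐ b ⟧ =
    Ω.⋁ {I = Σ Ω.Carrier λ p → p Ω.≤ E a Ω.∧ E b × a ↾ p ≈ b ↾ p} proj₁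

  field
    extensional : ∀ a b → E a Ω.≈ E b → E b Ω.≈ ⟦ a ≐ b ⟧ → a ≈ b

  module _ {i} {I : Set i} where

    Eᵗ : (I → Section) → Ω.Carrier
    Eᵗ a = Ω.⋀ λ i → E (a i)

    _↾ᵗ_ : (I → Section) → Ω.Carrier → (I → Section)
    (a ↾ᵗ p) i = a i ↾ p

    ⟦_≐_⟧ᵗ : (I → Section) → (I → Section) → Ω.Carrier
    ⟦ a ≐ b ⟧ᵗ = Ω.⋀ λ i → ⟦ a i ≐ b i ⟧

record Structure {ℓ} (Ω : CompleteHeytingAlgebra ℓ) (σ : Signature ℓ) :
                 Set (suc ℓ) where
  private module Ω = CompleteHeytingAlgebra Ω
  open Signature σ
  field
    presheaf : Presheaf Ω

  open Presheaf presheaf public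

  field
    rel   : ∀ R → (Fin (relArity R) → Section) → Ω.Carrier
    rel-E : ∀ R a → rel R a Ω.≤ Eᵗ a
    rel-≐ : ∀ R a b → ⟦ a ≐ b ⟧ᵗ Ω.∧ rel R a Ω.≤ rel R b
    fun   : ∀ f → (Fin (funArity f) → Section) → Section
    fun-E : ∀ f a → E (fun f a) Ω.≈ Eᵗ a
    fun-≐ : ∀ f a b → ⟦ a ≐ b ⟧ᵗ Ω.≤ ⟦ fun f a ≐ fun f b ⟧
    con   : ConSym → Section
    con-E : ∀ c → E (con c) Ω.≈ Ω.⊤

------------------------------------------------------------------------
-- Formulae

-- Unnested atomic formulae in variables from V.

data Atomic {ℓ v} (σ : Signature ℓ) (V : Set v) : Set (ℓ ⊔ v) where
  var≐var : V → V → Atomic σ V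
  var≐con : V → Signature.ConSym σ → Atomic σ V
  rel     : ∀ R → Vec V (Signature.relArity σ R) → Atomic σ V
  var≐fun : V → ∀ f → Vec V (Signature.funArity σ f) → Atomic σ V

vars : ∀ {ℓ v} {σ : Signature ℓ} {V : Set v} → Atomic σ V → List V
vars (var≐var x y)    = x ∷ y ∷ []
vars (var≐con x c)    = x ∷ []
vars (rel R xs)       = toList xs
vars (var≐fun x f xs) = x ∷ toList xs

rename : ∀ {ℓ v w} {σ : Signature ℓ} {V : Set v} {W : Set w} →
         (V → W) → Atomic σ V → Atomic σ W
rename g (var≐var x y)    = var≐var (g x) (g y)
rename g (var≐con x c)    = var≐con (g x) c
rename g (rel R xs)       = rel R (Vec.map g xs)
rename g (var≐fun x f xs) = var≐fun (g x) f (Vec.map g xs)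

module Formulae {ℓ} (Ω : CompleteHeytingAlgebra ℓ) (σ : Signature ℓ)
                (𝓛 : Logic ℓ) where

  private module Ω = CompleteHeytingAlgebra Ω
  open Ordinal (μ 𝓛) using (↓_) renaming (Carrier to Length) public

  -- The free variables of a formula are indexed by the positions Γ in the
  -- tuple to be substituted for them; the positions in a concatenation
  -- of tuples form a disjoint sum.

  data Formula (Γ : Set ℓ) : Set (suc (suc ℓ)) where
    atom : Atomic σ Γ → Formula Γ
    ⋀    : {I : Set (suc ℓ)} → (I → Formula Γ) → Formula Γ
    ∃̂    : (δ : Length) → Formula (Γ ⊎ (↓ δ)) → Formula Γ
    □    : Ω.Carrier → Formula Γ → Formula Γ

  infixr 7 _∧̂_
  _∧̂_ : ∀ {Γ} → Formula Γ → Formula Γ → Formula Γ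
  φ ∧̂ ψ = ⋀ {I = Lift _ Bool} λ { (lift true) → φ ; (lift false) → ψ }

  infixr 5 _⌢_
  _⌢_ : {A Γ Δ : Set ℓ} → (Γ → A) → (Δ → A) → (Γ ⊎ Δ → A)
  a ⌢ c = [ a , c ]′

  module _ (M : Structure Ω σ) where
    private module M = Structure M

    ⟦_⟧ᵃ : ∀ {Γ : Set ℓ} → Atomic σ Γ → (Γ → M.Section) → Ω.Carrier
    ⟦ var≐var x y    ⟧ᵃ a = M.⟦ a x ≐ a y ⟧
    ⟦ var≐con x c    ⟧ᵃ a = M.⟦ a x ≐ M.con c ⟧
    ⟦ rel R xs       ⟧ᵃ a = M.rel R λ i → a (lookup xs i)
    ⟦ var≐fun x f xs ⟧ᵃ a = M.⟦ a x ≐ M.fun f (λ i → a (lookup xs i)) ⟧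

    Value : ∀ {Γ : Set ℓ} → Formula Γ → (Γ → M.Section) → Ω.Carrier
    Value (atom ψ) a = M.Eᵗ a Ω.∧ ⟦ ψ ⟧ᵃ a
    Value (⋀ Φ)    a = M.Eᵗ a Ω.∧ Ω.⋀ λ i → Value (Φ i) a
    Value (∃̂ δ ψ)  a =
      M.Eᵗ a Ω.∧ Ω.⋁ λ (c : ↓ δ → M.Section) → Value ψ (a ⌢ c)
    Value (□ p ψ)  a = M.Eᵗ a Ω.∧ (p Ω.⇿ Value ψ a)

------------------------------------------------------------------------
-- The invariants φ and F, for stages in a well-ordered set W

module Invariants {ℓ} (Ω : CompleteHeytingAlgebra ℓ) (σ : Signature ℓ)
                  (𝓛 : Logic ℓ) (W : Ordinal ℓ) where

  private
    module Ω = CompleteHeytingAlgebra Ω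
    module W = Ordinal W
  open Formulae Ω σ 𝓛
  open Structure using (Section; Eᵗ; _↾ᵗ_)

  private
    variable
      Γ : Set ℓ

  -- The triples (K, s̄, t̄).

  record Extension (Γ : Set ℓ) : Set (suc ℓ) where
    field
      K : Structure Ω σ
      s : Γ → Section K
      δ : Length
      t : ↓ δ → Section K

    st : Γ ⊎ (↓ δ) → Section K
    st = s ⌢ t

  -- φ at zero, at the successor of a stage where it is given by φ, and at
  -- the limit of stages where it is given by the family φ.

  φ-zero : (M : Structure Ω σ) → (Γ → Section M) → Formula Γ
  φ-zero {Γ} M a = ⋀ {I = Lift _ (Atomic σ Γ)}
    λ (lift ψ) → □ (Value M (atom ψ) a) (atom ψ)

  φ-suc : (∀ {Γ} (M : Structure Ω σ) → (Γ → Section M) → Formula Γ) →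
          (M : Structure Ω σ) → (Γ → Section M) → Formula Γ
  φ-suc {Γ} φ M a =
    φ M a ∧̂ ⋀ {I = Extension Γ} λ e → let open Extension e in
      □ (Value M (∃̂ δ (φ K st)) a) (∃̂ δ (φ K st))

  φ-acc : ∀ α → Acc W._<_ α →
          (M : Structure Ω σ) → (Γ → Section M) → Formula Γ
  φ-acc α (acc rs) M a with W.kind α
  ... | least _           = φ-zero M a
  ... | successor β β<α _ = φ-suc (φ-acc β (rs β<α)) M a
  ... | limit _ _         =
    ⋀ {I = Lift _ (∃ λ β → β W.< α)}
      λ (lift (β , β<α)) → φ-acc β (rs β<α) M a

  φ : W.Carrier → (M : Structure Ω σ) → (Γ → Section M) → Formula Γ
  φ α = φ-acc α (W.wellFounded α)

  -- The functions F are hereditary: the arguments of one are tagged atomic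
  -- formulae or pairs of another such function and a stage.  They are
  -- represented by their graphs, the sets of pairs (key d , val d), d ∈ dom,
  -- and equality of functions is extensional equality of graphs.  Graphs
  -- are indexed by the length Γ of the tuple they come from, and the length
  -- of an argument from a longer tuple is recorded in the key.  This
  -- distinguishes nothing new, since a graph determines the length through
  -- its arguments (v₀ = v₀ , f).

  mutual
    record Graph (Γ : Set ℓ) : Set (suc (suc ℓ)) where
      inductive
      no-eta-equality
      constructor graph
      field
        dom : Set (suc ℓ)
        key : dom → Key Γ
        val : dom → Ω.Carrier

    data Key (Γ : Set ℓ) : Set (suc (suc ℓ)) where
      -- f : {0, …, n-1} → Γ is given as a vector.
      atomic : ∀ n → Atomic σ (Fin n) → Vec Γ n → Key Γ
      stage  : ∀ δ → Graph (Γ ⊎ (↓ δ)) → W.Carrier → Key Γ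

  open Graph

  mutual
    infix 4 _≃_ _≃ᵏ_

    data _≃_ {Γ : Set ℓ} (F G : Graph Γ) : Set (suc (suc ℓ)) where
      equal :
        (∀ d → ∃ λ e → key F d ≃ᵏ key G e × val F d Ω.≈ val G e) →
        (∀ e → ∃ λ d → key F d ≃ᵏ key G e × val F d Ω.≈ val G e) →
        F ≃ G

    data _≃ᵏ_ {Γ : Set ℓ} : Key Γ → Key Γ → Set (suc (suc ℓ)) where
      atomic : ∀ {n ψ f} → atomic n ψ f ≃ᵏ atomic n ψ f
      stage  : ∀ {δ F G β} → F ≃ G → stage δ F β ≃ᵏ stage δ G β

  _∪_ : Graph Γ → Graph Γ → Graph Γ
  F ∪ G = graph (dom F ⊎ dom G) [ key F , key G ]′ [ val F , val G ]′

  ⋃ : {I : Set ℓ} → (I → Graph Γ) → Graph Γ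
  ⋃ {I = I} F = graph (Σ I λ i → dom (F i))
    (λ (i , d) → key (F i) d) (λ (i , d) → val (F i) d)

  -- The value at (ψ , f) is that of ψ(v_{f(0)}, …, v_{f(n-1)}), as a formula
  -- in the variables v̄ with lh(v̄) = lh(ā), at the whole tuple ā; like every
  -- value at ā it is bounded by Eā.  Bounding it only by the extent of
  -- a_{f(0)}, …, a_{f(n-1)} would make F see truth values outside Eā, to
  -- which the formulae φ are insensitive.

  F-zero : (M : Structure Ω σ) → (Γ → Section M) → Graph Γ
  F-zero {Γ} M a = graph
    (Lift _ (Σ ℕ λ n → Σ (Atomic σ (Fin n)) λ ψ →
             (∀ j → j ∈ vars ψ) × Vec Γ n))
    (λ (lift (n , ψ , _ , f)) → atomic n ψ f)
    (λ (lift (n , ψ , _ , f)) → Value M (atom (rename (lookup f) ψ)) a)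

  F-suc : W.Carrier →
          (∀ {Γ} (M : Structure Ω σ) → (Γ → Section M) → Graph Γ) →
          (M : Structure Ω σ) → (Γ → Section M) → Graph Γ
  F-suc {Γ} β F M a = F M a ∪ graph
    (Σ (Extension Γ) λ e → let open Extension e in
       Eᵗ K t Ω.≤ Eᵗ M a Ω.∧ Eᵗ K s)
    (λ (e , _) → let open Extension e in stage δ (F K st) β)
    (λ (e , _) → let open Extension e in
       Ω.⋁ {I = Σ (↓ δ → Section M) λ c →
                  Eᵗ M c Ω.≤ Eᵗ K t ×
                  F K (_↾ᵗ_ K st (Eᵗ M c)) ≃ F M (a ⌢ c)}
           λ (c , _) → Eᵗ M c)

  F-acc : ∀ α → Acc W._<_ α →
          (M : Structure Ω σ) → (Γ → Section M) → Graph Γ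
  F-acc α (acc rs) M a with W.kind α
  ... | least _           = F-zero M a
  ... | successor β β<α _ = F-suc β (F-acc β (rs β<α)) M a
  ... | limit _ _         =
    ⋃ {I = ∃ λ β → β W.< α} λ (β , β<α) → F-acc β (rs β<α) M a

  F : W.Carrier → (M : Structure Ω σ) → (Γ → Section M) → Graph Γ
  F α = F-acc α (W.wellFounded α)

{-# OPTIONS --safe #-}
module Submission where

-- D α x y = [φ^α_x(y)] is an Ω-valued equality of tuples: it is symmetric and
-- transitive, D α x x is the extent of x, and equality of sections bounds it
-- from below.  The theorem at α reduces to its instances at β < α: the value
-- of F at (F^β_{K,s̄t̄}, β) and the value of ∃ū φ^β_{K,s̄t̄}(v̄,ū) carry the same
-- information, because a witness c̄ for the latter can be restricted to
-- q = [φ^β_{K,s̄t̄}(ā,c̄)], which makes its extent q.  Restriction does nothing to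
-- the empty tuple, whose extent is ⊤; but if c̄ and c̄′ are empty, then
-- [φ^β_{M,āc̄}(b̄c̄′)] is [φ^β_{M,ā}(b̄)] up to renaming of variables.

open import Defs
open import Data.Bool.Base using (true; false)
open import Data.Empty using (⊥-elim; ⊥-elim-irr)
open import Data.Fin.Base using (Fin; zero) renaming (suc to fsuc)
open import Data.Irrelevant using ([_])
open import Data.List.Membership.Propositional using (_∈_)
open import Data.List.Relation.Unary.Any using (here; there)
open import Data.Nat.Base using (ℕ)
open import Data.Product.Base using (Σ; _×_; _,_; proj₁; proj₂; ∃)
open import Data.Refinement.Base using (_,_)
open import Data.Sum.Base using (_⊎_; inj₁; inj₂)
open import Data.Sum.Function.Propositional using (_⊎-↔_)
open import Data.Vec.Base as Vec using (Vec; []; _∷_; lookup; allFin)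
open import Data.Vec.Membership.Propositional.Properties
  using (∈-allFin⁺; ∈-map⁺; ∈-toList⁺)
open import Data.Vec.Properties using (lookup-map; map-id; map-∘; map-lookup-allFin)
open import Function.Base using (id; _∘_)
open import Function.Bundles using (_↔_; _⇔_; mk⇔; Equivalence; Inverse; mk↔ₛ′)
open import Function.Construct.Identity using (↔-id)
open import Function.Construct.Symmetry using (↔-sym)
open import Induction.WellFounded using (Acc; acc)
open import Level using (lift; suc)
open import Relation.Binary.Bundles using (Setoid)
open import Relation.Binary.PropositionalEquality
  using (_≡_; refl; sym; trans; cong; subst)
open import Relation.Binary.Structures using (IsStrictTotalOrder)
open import Relation.Nullary.Negation.Core using (¬_)

-- Complete Heyting algebras.

module HeytingProperties {ℓ} (Ω : CompleteHeytingAlgebra ℓ) where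
  open CompleteHeytingAlgebra Ω renaming (trans to ≤-trans)

  ⋀-greatest : ∀ {i} {I : Set i} {x : I → Carrier} {y} →
               (∀ k → y ≤ x k) → y ≤ ⋀ x
  ⋀-greatest h = ⋁-upper proj₁ (_ , h)

  ⋀-lower : ∀ {i} {I : Set i} {x : I → Carrier} k → ⋀ x ≤ x k
  ⋀-lower k = ⋁-least proj₁ _ λ (_ , h) → h k

  ∧-swap : ∀ {x y} → x ∧ y ≤ y ∧ x
  ∧-swap {x} {y} = ∧-greatest (x∧y≤y x y) (x∧y≤x x y)

  -- Frame distributivity: meeting with `y` is a left adjoint, so it commutes with joins.
  ∧-⋁-least : ∀ {i} {I : Set i} {x : I → Carrier} {y z} →
              (∀ k → y ∧ x k ≤ z) → y ∧ ⋁ x ≤ z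
  ∧-⋁-least h = ≤-trans ∧-swap (transpose-∧
    (⋁-least _ _ λ k → transpose-⇨ (≤-trans ∧-swap (h k))))

  ∧-weaken₁ : ∀ {x y z} → x ≤ z → x ∧ y ≤ z
  ∧-weaken₁ = ≤-trans (x∧y≤x _ _)

  ∧-weaken₂ : ∀ {x y z} → y ≤ z → x ∧ y ≤ z
  ∧-weaken₂ = ≤-trans (x∧y≤y _ _)

  -- `x ≤ p ⇿ q` says that `p` and `q` have the same meet with `x`. Equivalences are always used
  -- relative to such a bound.
  ⇿-intro : ∀ {x p q} → x ∧ p ≤ q → x ∧ q ≤ p → x ≤ p ⇿ q
  ⇿-intro h k = ∧-greatest (transpose-⇨ h) (transpose-⇨ k)

  ⇿-sym : ∀ {x p q} → x ≤ p ⇿ q → x ≤ q ⇿ p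
  ⇿-sym h = ≤-trans h ∧-swap

  ⇿-mp : ∀ {x p q} → x ≤ p ⇿ q → x ≤ p → x ≤ q
  ⇿-mp h k =
    ≤-trans (∧-greatest (≤-trans h (x∧y≤x _ _)) k) (transpose-∧ (reflexive Eq.refl))

  ⇿-trans : ∀ {x p q r} → x ≤ p ⇿ q → x ≤ q ⇿ r → x ≤ p ⇿ r
  ⇿-trans h k = ⇿-intro (go h k) (go (⇿-sym k) (⇿-sym h))
    where
    go : ∀ {x p q r} → x ≤ p ⇿ q → x ≤ q ⇿ r → x ∧ p ≤ r
    go h k = ⇿-mp (∧-weaken₁ k) (⇿-mp (∧-weaken₁ h) (x∧y≤y _ _))

-- Local equality of sections.

module PresheafProperties {ℓ} {Ω : CompleteHeytingAlgebra ℓ}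
                          (P : Presheaf Ω) where
  open CompleteHeytingAlgebra Ω renaming (trans to ≤-trans)
    hiding (_≈_; isEquivalence)
  private module Ω = CompleteHeytingAlgebra Ω
  open HeytingProperties Ω
  open Presheaf P
  private module S = Setoid sections

  ≐-Eʳ : ∀ {a b} → ⟦ a ≐ b ⟧ ≤ E b
  ≐-Eʳ = ⋁-least _ _ λ (_ , h , _) → ≤-trans h (x∧y≤y _ _)

  ≐-refl : ∀ {a b} → a ≈ b → E a ≤ ⟦ a ≐ b ⟧
  ≐-refl {a} {b} a≈b = ⋁-upper proj₁
    (E a , ∧-greatest Ω.refl (reflexive (E-cong a≈b)) , ↾-cong a≈b Eq.refl)

  ≐-sym : ∀ {a b} → ⟦ a ≐ b ⟧ ≤ ⟦ b ≐ a ⟧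
  ≐-sym = ⋁-least _ _ λ (p , h , e) →
    ⋁-upper proj₁ (p , ≤-trans h ∧-swap , S.sym e)

  -- Distributing the meet over both joins leaves `p` and `q` on which the two pairs agree; on
  -- `q ∧ p` all three sections agree.
  ≐-trans : ∀ {x a b c} → x ≤ ⟦ a ≐ b ⟧ → x ≤ ⟦ b ≐ c ⟧ → x ≤ ⟦ a ≐ c ⟧
  ≐-trans {a = a} {b} {c} h k = ≤-trans (∧-greatest h k)
    (∧-⋁-least λ (q , q≤ , b≈c) → ≤-trans ∧-swap
      (∧-⋁-least λ (p , p≤ , a≈b) → ⋁-upper proj₁
        (q ∧ p
        , ∧-greatest (∧-weaken₂ (≤-trans p≤ (x∧y≤x _ _)))
                     (∧-weaken₁ (≤-trans q≤ (x∧y≤y _ _)))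
        , S.trans (↾-cong S.refl swap) (S.trans (S.sym (↾-↾ a p q))
          (S.trans (↾-cong a≈b Eq.refl) (S.trans (↾-↾ b p q)
          (S.trans (↾-cong S.refl swap) (S.trans (S.sym (↾-↾ b q p))
          (S.trans (↾-cong b≈c Eq.refl) (↾-↾ c q p))))))))))
    where
    swap : ∀ {p q} → p ∧ q Ω.≈ q ∧ p
    swap = antisym ∧-swap ∧-swap

  ≐-↾ : ∀ {a q} → E a ∧ q ≤ ⟦ a ≐ a ↾ q ⟧
  ≐-↾ {a} {q} = ⋁-upper proj₁
    ( E a ∧ q
    , ∧-greatest (x∧y≤x _ _) (reflexive (Eq.sym (E-↾ a q)))
    , S.trans (↾-cong S.refl
        (antisym (∧-greatest (x∧y≤y _ _) Ω.refl) (x∧y≤y _ _)))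
        (S.sym (↾-↾ a q (E a ∧ q))) )

  module _ {i} {I : Set i} where

    ≐ᵗ-sym : ∀ {a b : I → Section} → ⟦ a ≐ b ⟧ᵗ ≤ ⟦ b ≐ a ⟧ᵗ
    ≐ᵗ-sym = ⋀-greatest λ i → ≤-trans (⋀-lower i) ≐-sym

    -- The index excludes the empty tuple, which has extent `⊤` even after restriction.
    Eᵗ-↾ᵗ-≤ : ∀ {a : I → Section} q → I → Eᵗ (a ↾ᵗ q) ≤ q
    Eᵗ-↾ᵗ-≤ q i = ≤-trans (⋀-lower i)
      (≤-trans (reflexive (E-↾ _ q)) (x∧y≤y _ _))

    Eᵗ-↾ᵗ-≥ : ∀ {a : I → Section} {q x} → x ≤ Eᵗ a → x ≤ q → x ≤ Eᵗ (a ↾ᵗ q)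
    Eᵗ-↾ᵗ-≥ h k = ⋀-greatest λ i →
      ≤-trans (∧-greatest (≤-trans h (⋀-lower i)) k) (reflexive (Eq.sym (E-↾ _ _)))

    Eᵗ-↾ᵗ-mono : ∀ {a : I → Section} {q} → Eᵗ (a ↾ᵗ q) ≤ Eᵗ a
    Eᵗ-↾ᵗ-mono = ⋀-greatest λ i → ≤-trans (⋀-lower i)
      (≤-trans (reflexive (E-↾ _ _)) (x∧y≤x _ _))

    ≐-↾ᵗ : ∀ {a : I → Section} {q x} → x ≤ Eᵗ a → x ≤ q →
           ∀ i → x ≤ ⟦ a i ≐ (a ↾ᵗ q) i ⟧
    ≐-↾ᵗ h k i = ≤-trans (∧-greatest (≤-trans h (⋀-lower i)) k) ≐-↾

-- Atomic formulae under renaming.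

module AtomicProperties {ℓ} {σ : Signature ℓ} where

  record Normal {V : Set ℓ} (ψ : Atomic σ V) : Set ℓ where
    constructor normal
    field
      {arity} : ℕ
      form    : Atomic σ (Fin arity)
      covers  : ∀ j → j ∈ vars form
      assign  : Vec V arity
      renames : rename (lookup assign) form ≡ ψ

  -- `φ` at zero ranges over all atomic formulae, `F` at zero only over those in exactly v₀, ...,
  -- v₍ₙ₋₁₎. Repetitions of a variable are moved into the assignment, so `form` can use a fresh
  -- variable at each place.
  normalise : ∀ {V : Set ℓ} (ψ : Atomic σ V) → Normal ψ
  normalise (var≐var x y) = normal {arity = 2} (var≐var zero (fsuc zero))
    (λ { zero → here refl ; (fsuc zero) → there (here refl) })
    (x ∷ y ∷ []) refl
  normalise (var≐con x c) = normal {arity = 1} (var≐con zero c)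
    (λ { zero → here refl }) (x ∷ []) refl
  normalise (rel R xs) = normal (rel R (allFin _))
    (∈-toList⁺ ∘ ∈-allFin⁺) xs (cong (rel R) (map-lookup-allFin xs))
  normalise (var≐fun x f xs) = normal (var≐fun zero f (Vec.map fsuc (allFin _)))
    (λ { zero → here refl
       ; (fsuc j) → there (∈-toList⁺ (∈-map⁺ fsuc (∈-allFin⁺ j))) })
    (x ∷ xs)
    (cong (var≐fun x f) (trans (sym (map-∘ _ _ _)) (map-lookup-allFin xs)))

  rename-id : ∀ {V : Set ℓ} (ψ : Atomic σ V) → rename id ψ ≡ ψ
  rename-id (var≐var x y)    = refl
  rename-id (var≐con x c)    = refl
  rename-id (rel R xs)       = cong (rel R) (map-id xs)
  rename-id (var≐fun x f xs) = cong (var≐fun x f) (map-id xs)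

  module _ {Ω : CompleteHeytingAlgebra ℓ} (𝓛 : Logic ℓ) (M : Structure Ω σ) where
    open CompleteHeytingAlgebra Ω renaming (trans to ≤-trans) using (_≤_; ∧-greatest)
    open HeytingProperties Ω
    open Formulae Ω σ 𝓛 using (⟦_⟧ᵃ)
    open Structure M
    open PresheafProperties presheaf

    lookup-≐ : ∀ {Γ Δ : Set ℓ} (g : Γ → Δ) {n} (is : Vec Γ n)
               (a : Γ → Section) (b : Δ → Section) {x} →
               (∀ i → x ≤ ⟦ a i ≐ b (g i) ⟧) →
               x ≤ ⟦ (λ j → a (lookup is j)) ≐ (λ j → b (lookup (Vec.map g is) j)) ⟧ᵗ
    lookup-≐ g is a b {x} h = ⋀-greatest λ j →
      subst (λ i → x ≤ ⟦ a (lookup is j) ≐ b i ⟧)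
        (sym (lookup-map j g is)) (h (lookup is j))

    -- Covers two uses at once: `g = id` gives invariance under local equality, a bijection `g`
    -- gives reindexing. The converse is separate since `g` need not be invertible.
    ⟦rename⟧⁺ : ∀ {Γ Δ : Set ℓ} (g : Γ → Δ) (ψ : Atomic σ Γ)
               {a : Γ → Section} {b : Δ → Section} {x} →
               (∀ i → x ≤ ⟦ a i ≐ b (g i) ⟧) →
               x ≤ ⟦_⟧ᵃ M ψ a → x ≤ ⟦_⟧ᵃ M (rename g ψ) b
    ⟦rename⟧⁺ g (var≐var i j) h k =
      ≐-trans (≤-trans (h i) ≐-sym) (≐-trans k (h j))
    ⟦rename⟧⁺ g (var≐con i c) h k = ≐-trans (≤-trans (h i) ≐-sym) k
    ⟦rename⟧⁺ g (rel R is) {a} {b} h k =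
      ≤-trans (∧-greatest (lookup-≐ g is a b h) k) (rel-≐ R _ _)
    ⟦rename⟧⁺ g (var≐fun i f is) {a} {b} h k =
      ≐-trans (≤-trans (h i) ≐-sym)
        (≐-trans k (≤-trans (lookup-≐ g is a b h) (fun-≐ f _ _)))

    ⟦rename⟧⁻ : ∀ {Γ Δ : Set ℓ} (g : Γ → Δ) (ψ : Atomic σ Γ)
               {a : Γ → Section} {b : Δ → Section} {x} →
               (∀ i → x ≤ ⟦ a i ≐ b (g i) ⟧) →
               x ≤ ⟦_⟧ᵃ M (rename g ψ) b → x ≤ ⟦_⟧ᵃ M ψ a
    ⟦rename⟧⁻ g (var≐var i j) h k =
      ≐-trans (h i) (≐-trans k (≤-trans (h j) ≐-sym))
    ⟦rename⟧⁻ g (var≐con i c) h k = ≐-trans (h i) k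
    ⟦rename⟧⁻ g (rel R is) {a} {b} h k =
      ≤-trans (∧-greatest (≤-trans (lookup-≐ g is a b h) ≐ᵗ-sym) k) (rel-≐ R _ _)
    ⟦rename⟧⁻ g (var≐fun i f is) {a} {b} h k =
      ≐-trans (h i) (≐-trans k
        (≤-trans (lookup-≐ g is a b h) (≤-trans ≐ᵗ-sym (fun-≐ f _ _))))

module Characterisation {ℓ} (Ω : CompleteHeytingAlgebra ℓ) (σ : Signature ℓ)
                        (𝓛 : Logic ℓ) (W : Ordinal ℓ) where
  open CompleteHeytingAlgebra Ω renaming (trans to ≤-trans; refl to ≤-refl)
    hiding (isEquivalence)
  open HeytingProperties Ω
  open AtomicProperties {ℓ} {σ}
  open Formulae Ω σ 𝓛
  open Invariants Ω σ 𝓛 W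
  open Graph
  private
    module W = Ordinal W
    module W< = IsStrictTotalOrder W.isStrictTotalOrder
    module S (M : Structure Ω σ) = Setoid (Structure.sections M)
    module P (M : Structure Ω σ) = PresheafProperties (Structure.presheaf M)
  open Structure using (Section; Eᵗ; _↾ᵗ_; ⟦_≐_⟧)

  private
    variable
      Γ Δ : Set ℓ
      α β : W.Carrier
      u v : Carrier

  record Point (Γ : Set ℓ) : Set (suc ℓ) where
    constructor point
    field
      str : Structure Ω σ
      tup : Γ → Section str

    extent : Carrier
    extent = Eᵗ str tup

    value : Atomic σ Γ → Carrier
    value ψ = Value str (atom ψ) tup

  open Point

  infixl 5 _▸_
  _▸_ : ∀ {δ} (x : Point Γ) → (↓ δ → Section (str x)) → Point (Γ ⊎ (↓ δ))
  x ▸ c = point (str x) (tup x ⌢ c)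

  ext : (e : Extension Γ) → Point (Γ ⊎ (↓ (Extension.δ e)))
  ext e = point (Extension.K e) (Extension.st e)

  Eᵗ-⌢ : ∀ (M : Structure Ω σ) {A B : Set ℓ} {a : A → Section M} {c : B → Section M} →
         u ≤ Eᵗ M a → u ≤ Eᵗ M c → u ≤ Eᵗ M (a ⌢ c)
  Eᵗ-⌢ M h k = ⋀-greatest
    λ { (inj₁ i) → ≤-trans h (⋀-lower i) ; (inj₂ j) → ≤-trans k (⋀-lower j) }

  Eᵗ-⌢ˡ : ∀ (M : Structure Ω σ) {A B : Set ℓ} {a : A → Section M} {c : B → Section M} →
          Eᵗ M (a ⌢ c) ≤ Eᵗ M a
  Eᵗ-⌢ˡ M = ⋀-greatest λ i → ⋀-lower (inj₁ i)

  Eᵗ-⌢ʳ : ∀ (M : Structure Ω σ) {A B : Set ℓ} {a : A → Section M} {c : B → Section M} →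
          Eᵗ M (a ⌢ c) ≤ Eᵗ M c
  Eᵗ-⌢ʳ M = ⋀-greatest λ j → ⋀-lower (inj₂ j)

  -- The Ω-valued equality of tuples.

  Dᵃ : ∀ α → Acc W._<_ α → Point Γ → Point Γ → Carrier
  Dᵃ α p x y = Value (str y) (φ-acc α p (str x) (tup x)) (tup y)

  ∃ᵃ : ∀ α → Acc W._<_ α → Extension Γ → Point Γ → Carrier
  ∃ᵃ α p e y = extent y ∧ ⋁ λ c → Dᵃ α p (ext e) (y ▸ c)

  ∃ᵃ-cong : ∀ (p q : Acc W._<_ α) (e : Extension Γ) (y : Point Γ) →
            (∀ {Δ} (x y : Point Δ) → Dᵃ α p x y ≤ Dᵃ α q x y) →
            (∀ {Δ} (x y : Point Δ) → Dᵃ α q x y ≤ Dᵃ α p x y) →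
            u ≤ ∃ᵃ α p e y ⇿ ∃ᵃ α q e y
  ∃ᵃ-cong {α = α} p q e y h k =
    ⇿-intro (∧-weaken₂ (mono p q h)) (∧-weaken₂ (mono q p k))
    where
    mono : ∀ p q → (∀ {Δ} (x y : Point Δ) → Dᵃ α p x y ≤ Dᵃ α q x y) →
           ∃ᵃ α p e y ≤ ∃ᵃ α q e y
    mono p q h = ∧-greatest (x∧y≤x _ _)
      (∧-weaken₂ (⋁-least _ _ λ c → ≤-trans (h (ext e) (y ▸ c)) (⋁-upper _ c)))

  -- Unfolding at `α` yields the accessibility proof `rs β<α`, not `W.wellFounded β`. The boxed
  -- truth values depend on it too, so both sides of each equivalence are changed.
  Dᵃ-irr : ∀ (p q : Acc W._<_ α) (x y : Point Γ) → Dᵃ α p x y ≤ Dᵃ α q x y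
  Dᵃ-irr {α} (acc rs) (acc rs′) x y with W.kind α
  ... | least _ = ≤-refl
  ... | successor β β<α _ = ∧-greatest (x∧y≤x _ _) (∧-weaken₂ (⋀-greatest
    λ { (lift true) → ≤-trans (⋀-lower (lift true)) (Dᵃ-irr (rs β<α) (rs′ β<α) x y)
      ; (lift false) → ≤-trans (⋀-lower (lift false))
          (∧-greatest (x∧y≤x _ _) (∧-weaken₂ (⋀-greatest λ e → ≤-trans (⋀-lower e)
            (∧-greatest (x∧y≤x _ _) (∧-weaken₂
              (⇿-trans (⇿-sym (same e x)) (⇿-trans ≤-refl (same e y)))))))) }))
    where
    same : ∀ e z → u ≤ ∃ᵃ β (rs β<α) e z ⇿ ∃ᵃ β (rs′ β<α) e z
    same e z = ∃ᵃ-cong (rs β<α) (rs′ β<α) e z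
      (Dᵃ-irr (rs β<α) (rs′ β<α)) (Dᵃ-irr (rs′ β<α) (rs β<α))
  ... | limit _ _ = ∧-greatest (x∧y≤x _ _) (∧-weaken₂ (⋀-greatest
    λ (lift (β , β<α)) → ≤-trans (⋀-lower (lift (β , β<α)))
      (Dᵃ-irr (rs β<α) (rs′ β<α) x y)))

  opaque
    -- Opaque, to hide the recursion on stages: after the next opaque block only `D-extent`,
    -- `D-atom`, `D-∃` and `D-greatest` are used, and `D-≈⇔Value-≈` leads back to the formulae at
    -- the end.
    D : W.Carrier → Point Γ → Point Γ → Carrier
    D α = Dᵃ α (W.wellFounded α)

    D-≈⇔Value-≈ : ∀ {x y : Point Γ} →
                  D α x y ≈ D α y y ⇔
                  Value (str y) (φ α (str x) (tup x)) (tup y) ≈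
                  Value (str y) (φ α (str y) (tup y)) (tup y)
    D-≈⇔Value-≈ = mk⇔ id id

  ∃ᴰ : W.Carrier → Extension Γ → Point Γ → Carrier
  ∃ᴰ β e y = extent y ∧ ⋁ λ c → D β (ext e) (y ▸ c)

  opaque
    unfolding D

    ∃ᵃ-⇿-∃ᴰ : ∀ (p : Acc W._<_ α) (e : Extension Γ) (x : Point Γ) →
              u ≤ ∃ᵃ α p e x ⇿ ∃ᴰ α e x
    ∃ᵃ-⇿-∃ᴰ {α} p e x =
      let q = W.wellFounded α in ∃ᵃ-cong p q e x (Dᵃ-irr p q) (Dᵃ-irr q p)

    D-extent : ∀ {x y : Point Γ} → D α x y ≤ extent y
    D-extent {α = α} with W.wellFounded α
    ... | acc rs with W.kind α
    ...   | least _         = x∧y≤x _ _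
    ...   | successor _ _ _ = x∧y≤x _ _
    ...   | limit _ _       = x∧y≤x _ _

    D-atom : ∀ {x y : Point Γ} ψ → D α x y ≤ value x ψ ⇿ value y ψ
    D-atom {α = α} ψ = go (W.wellFounded α)
      where
      go : ∀ {x y α} (p : Acc W._<_ α) →
           Dᵃ α p x y ≤ value x ψ ⇿ value y ψ
      go {α = α} (acc rs) with W.kind α
      ... | least _ = ∧-weaken₂ (≤-trans (⋀-lower (lift ψ)) (x∧y≤y _ _))
      ... | successor β β<α _ =
        ∧-weaken₂ (≤-trans (⋀-lower (lift true)) (go (rs β<α)))
      ... | limit (β , β<α) _ =
        ∧-weaken₂ (≤-trans (⋀-lower (lift (β , β<α))) (go (rs β<α)))

    D-∃ : ∀ {x y : Point Γ} → β W.< α → ∀ e → D α x y ≤ ∃ᴰ β e x ⇿ ∃ᴰ β e y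
    D-∃ {β = β} {α} β<α e = go (W.wellFounded α) β<α
      where
      go : ∀ {x y α} (p : Acc W._<_ α) → β W.< α →
           Dᵃ α p x y ≤ ∃ᴰ β e x ⇿ ∃ᴰ β e y
      go {x} {y} {α} (acc rs) β<α with W.kind α
      ... | least ≮α = ⊥-elim (≮α _ β<α)
      -- The conjunct for `β` enters only at the successor of `β`, so a stage strictly between `β`
      -- and `α` is taken.
      ... | limit _ dense with _ , β<γ , γ<α ← dense _ β<α =
        ∧-weaken₂ (≤-trans (⋀-lower (lift (_ , γ<α))) (go (rs γ<α) β<γ))
      ... | successor γ γ<α below with below _ β<α
      ...   | inj₂ β<γ = ∧-weaken₂ (≤-trans (⋀-lower (lift true)) (go (rs γ<α) β<γ))
      ...   | inj₁ refl = ∧-weaken₂ (≤-trans (⋀-lower (lift false)) (∧-weaken₂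
        (≤-trans (⋀-lower e) (∧-weaken₂
          (⇿-trans (⇿-sym (∃ᵃ-⇿-∃ᴰ (rs γ<α) e x))
            (⇿-trans ≤-refl (∃ᵃ-⇿-∃ᴰ (rs γ<α) e y)))))))

    -- With the three preceding bounds, this describes `D α x y` as a greatest element, uniformly in
    -- the kind of `α`.
    D-greatest : ∀ {x y : Point Γ} → u ≤ extent y →
                 (∀ ψ → u ≤ value x ψ ⇿ value y ψ) →
                 (∀ {β} → β W.< α → ∀ e → u ≤ ∃ᴰ β e x ⇿ ∃ᴰ β e y) →
                 u ≤ D α x y
    D-greatest {u = u} {α} {x} {y} u≤E atoms = go (W.wellFounded α)
      where
      go : ∀ {α} (p : Acc W._<_ α) →
           (∀ {β} → β W.< α → ∀ e → u ≤ ∃ᴰ β e x ⇿ ∃ᴰ β e y) → u ≤ Dᵃ α p x y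
      go {α} (acc rs) exts with W.kind α
      ... | least _ = ∧-greatest u≤E (⋀-greatest λ (lift ψ) →
        ∧-greatest u≤E (atoms ψ))
      ... | limit _ _ = ∧-greatest u≤E (⋀-greatest λ (lift (β , β<α)) →
        go (rs β<α) λ γ<β → exts (W<.trans γ<β β<α))
      ... | successor β β<α _ = ∧-greatest u≤E (⋀-greatest
        λ { (lift true) → go (rs β<α) λ γ<β → exts (W<.trans γ<β β<α)
          ; (lift false) → ∧-greatest u≤E (⋀-greatest λ e → ∧-greatest u≤E
              (⇿-trans (∃ᵃ-⇿-∃ᴰ (rs β<α) e x)
                (⇿-trans (exts β<α e) (⇿-sym (∃ᵃ-⇿-∃ᴰ (rs β<α) e y))))) })

  -- The formula vᵢ = vᵢ holds at `y` on all of `extent y`, and its value at `x` is bounded by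
  -- `extent x`.
  D-extentˡ : ∀ {x y : Point Γ} → D α x y ≤ extent x
  D-extentˡ {x = x} {y} = ⋀-greatest λ i →
    ≤-trans (⇿-mp (⇿-sym (D-atom (var≐var i i)))
      (∧-greatest D-extent (≤-trans D-extent
        (≤-trans (⋀-lower i) (P.≐-refl (str y) (S.refl (str y)))))))
      (≤-trans (x∧y≤x _ _) (⋀-lower i))

  -- Through the boxes, `φ` only compares truth values at `x` with those at `y`, and `⇿` is
  -- symmetric.
  D-sym : ∀ {x y : Point Γ} → D α x y ≤ D α y x
  D-sym = D-greatest D-extentˡ (⇿-sym ∘ D-atom) λ β<α e → ⇿-sym (D-∃ β<α e)

  D-trans : ∀ {x y z : Point Γ} → u ≤ D α x y → u ≤ D α y z → u ≤ D α x z
  D-trans h k = D-greatest (≤-trans k D-extent)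
    (λ ψ → ⇿-trans (≤-trans h (D-atom ψ)) (≤-trans k (D-atom ψ)))
    (λ β<α e → ⇿-trans (≤-trans h (D-∃ β<α e)) (≤-trans k (D-∃ β<α e)))

  ∃ᴰ-intro : ∀ {e : Extension Γ} {y} c → u ≤ D β (ext e) (y ▸ c) → u ≤ ∃ᴰ β e y
  ∃ᴰ-intro {y = y} c h = ∧-greatest
    (≤-trans h (≤-trans D-extent (Eᵗ-⌢ˡ (str y)))) (≤-trans h (⋁-upper _ c))

  ∃ᴰ-elim : ∀ {e : Extension Γ} {y} →
            (∀ c → u ∧ D β (ext e) (y ▸ c) ≤ v) → u ∧ ∃ᴰ β e y ≤ v
  ∃ᴰ-elim h = ≤-trans (∧-greatest (x∧y≤x _ _) (∧-weaken₂ (x∧y≤y _ _))) (∧-⋁-least h)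

  -- Locality.

  value-local : ∀ {M} {a b : Γ → Section M} ψ →
                (∀ i → u ≤ ⟦ M ≐ a i ⟧ (b i)) →
                u ∧ value (point M a) ψ ≤ value (point M b) ψ
  value-local {M = M} {a} {b} ψ h = ∧-greatest
    (∧-weaken₁ (⋀-greatest λ i → ≤-trans (h i) (P.≐-Eʳ M)))
    (subst (λ χ → _ ∧ value (point M a) ψ ≤ ⟦_⟧ᵃ M χ b) (rename-id ψ)
      (⟦rename⟧⁺ 𝓛 M id ψ (λ i → ∧-weaken₁ (h i)) (∧-weaken₂ (x∧y≤y _ _))))

  -- Induction on `α`: a witness `c` for one tuple also serves for the other, since `c` equals
  -- itself on its extent and the induction hypothesis applies to the two concatenations.
  D-local : ∀ {M} {a b : Γ → Section M} → (∀ i → u ≤ ⟦ M ≐ a i ⟧ (b i)) →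
            u ≤ D α (point M a) (point M b)
  D-local {α = α} {M = M} = go (W.wellFounded α)
    where
    go : ∀ {Γ u α} → Acc W._<_ α → {a b : Γ → Section M} →
         (∀ i → u ≤ ⟦ M ≐ a i ⟧ (b i)) → u ≤ D α (point M a) (point M b)
    go {u = u} (acc rs) {a} {b} h = D-greatest
      (⋀-greatest λ i → ≤-trans (h i) (P.≐-Eʳ M))
      (λ ψ → ⇿-intro (value-local ψ h) (value-local ψ h′))
      (λ β<α e → ⇿-intro (half β<α e h) (half β<α e h′))
      where
      h′ : ∀ i → u ≤ ⟦ M ≐ b i ⟧ (a i)
      h′ i = ≤-trans (h i) (P.≐-sym M)

      half : ∀ {β a b} → β W.< _ → ∀ e → (∀ i → u ≤ ⟦ M ≐ a i ⟧ (b i)) →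
             u ∧ ∃ᴰ β e (point M a) ≤ ∃ᴰ β e (point M b)
      half β<α e h = ∃ᴰ-elim λ c → ∃ᴰ-intro c (D-trans (x∧y≤y _ _)
        (go (rs β<α)
          λ { (inj₁ i) → ∧-weaken₁ (h i)
            ; (inj₂ j) → ∧-weaken₂ (≤-trans D-extent (≤-trans (⋀-lower (inj₂ j))
                (P.≐-refl M (S.refl M)))) }))

  -- Bijections of positions.

  Reindexed : ∀ (M : Structure Ω σ) → Γ ↔ Δ → (Γ → Section M) → (Δ → Section M) →
              Set ℓ
  Reindexed M g a a′ = ∀ i → S._≈_ M (a′ (Inverse.to g i)) (a i)

  Reindexed-sym : ∀ (M : Structure Ω σ) (g : Γ ↔ Δ) {a a′} →
                  Reindexed M g a a′ → Reindexed M (↔-sym g) a′ a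
  Reindexed-sym M g {a′ = a′} r j = S.trans M (S.sym M (r (Inverse.from g j)))
    (S.reflexive M (cong a′ (Inverse.strictlyInverseˡ g j)))

  Reindexed-⌢ : ∀ (M : Structure Ω σ) (g : Γ ↔ Δ) {a a′} {A : Set ℓ}
                {c : A → Section M} →
                Reindexed M g a a′ →
                Reindexed M (g ⊎-↔ ↔-id A) (a ⌢ c) (a′ ⌢ c)
  Reindexed-⌢ M g r (inj₁ i) = r i
  Reindexed-⌢ M g r (inj₂ j) = S.refl M

  extent-reindex : ∀ (M : Structure Ω σ) (g : Γ ↔ Δ) {a a′} →
                   Reindexed M g a a′ → Eᵗ M a ≤ Eᵗ M a′
  extent-reindex M g r = ⋀-greatest λ j → ≤-trans (⋀-lower (Inverse.from g j))
    (reflexive (Structure.E-cong M (Reindexed-sym M g r j)))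

  value-reindex : ∀ (M : Structure Ω σ) (g : Γ ↔ Δ) {a a′} → Reindexed M g a a′ →
                  ∀ ψ → u ≤ value (point M a) (rename (Inverse.from g) ψ) ⇿
                            value (point M a′) ψ
  value-reindex M g {a} {a′} r ψ = ⇿-intro
    (∧-weaken₂ (∧-greatest E≤E′ (⟦rename⟧⁻ 𝓛 M (Inverse.from g) ψ
      (λ j → ≤-trans E≤E′ (same j)) (x∧y≤y _ _))))
    (∧-weaken₂ (∧-greatest
      (∧-weaken₁ (extent-reindex M (↔-sym g) (Reindexed-sym M g r)))
      (⟦rename⟧⁺ 𝓛 M (Inverse.from g) ψ (λ j → ∧-weaken₁ (same j)) (x∧y≤y _ _))))
    where
    E≤E′ : Eᵗ M a ∧ v ≤ Eᵗ M a′
    E≤E′ = ∧-weaken₁ (extent-reindex M g r)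

    same : ∀ j → Eᵗ M a′ ≤ ⟦ M ≐ a′ j ⟧ (a (Inverse.from g j))
    same j = ≤-trans (⋀-lower j) (P.≐-refl M (S.sym M (Reindexed-sym M g r j)))

  -- Extensions of a tuple over `Δ` become extensions over `Γ` by composing `s` with the bijection
  -- and keeping `t`. The induction passes to `g ⊎-↔ ↔-id _`, so `go` is general in the bijection.
  -- The use is for `Γ` and `Γ ⊎ (↓ δ)` with `↓ δ` empty.
  D-reindex : ∀ (M N : Structure Ω σ) (g : Γ ↔ Δ) {a a′ b b′} →
              Reindexed M g a a′ → Reindexed N g b b′ →
              D α (point M a) (point N b) ≤ D α (point M a′) (point N b′)
  D-reindex {α = α} M N g = go (W.wellFounded α) M N g
    where
    go : ∀ {Γ Δ α} → Acc W._<_ α →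
         ∀ (M N : Structure Ω σ) (g : Γ ↔ Δ) {a a′ b b′} →
         Reindexed M g a a′ → Reindexed N g b b′ →
         D α (point M a) (point N b) ≤ D α (point M a′) (point N b′)
    go {α = α} (acc rs) M N g {a} {a′} {b} {b′} r q = D-greatest
      (≤-trans D-extent (extent-reindex N g q))
      (λ ψ → ⇿-trans (⇿-sym (value-reindex M g r ψ))
        (⇿-trans (D-atom (rename (Inverse.from g) ψ)) (value-reindex N g q ψ)))
      λ β<α e → ⇿-trans (⇿-sym (∃-reindex M β<α e r))
        (⇿-trans (D-∃ β<α _) (∃-reindex N β<α e q))
      where
      half : ∀ {Γ Δ β} → β W.< α → ∀ {δ} (K M : Structure Ω σ) (g : Γ ↔ Δ) {s s′ a a′}
             {t : ↓ δ → Section K} → Reindexed K g s s′ → Reindexed M g a a′ →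
             ∃ᴰ β (record { K = K ; s = s ; t = t }) (point M a) ≤
             ∃ᴰ β (record { K = K ; s = s′ ; t = t }) (point M a′)
      half β<α K M g r q = ≤-trans (∧-greatest ≤-refl ≤-refl) (∃ᴰ-elim λ c →
        ∃ᴰ-intro c (∧-weaken₂ (go (rs β<α) K M (g ⊎-↔ ↔-id _)
          (Reindexed-⌢ K g r) (Reindexed-⌢ M g q))))

      ∃-reindex : ∀ {β} M → β W.< α → ∀ e {a a′} → Reindexed M g a a′ →
                  let open Extension e in
                  u ≤ ∃ᴰ β (record { K = K ; s = s ∘ Inverse.to g ; t = t })
                           (point M a) ⇿
                      ∃ᴰ β e (point M a′)
      ∃-reindex M β<α e r = let open Extension e in ⇿-intro
        (∧-weaken₂ (half β<α K M g (λ _ → S.refl K) r))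
        (∧-weaken₂ (half β<α K M (↔-sym g)
          (Reindexed-sym K g λ _ → S.refl K) (Reindexed-sym M g r)))

  -- Equality of graphs.

  mutual
    ≃-sym : {F G : Graph Γ} → F ≃ G → G ≃ F
    ≃-sym (equal h k) = equal
      (λ e → let d , κ , ν = k e in d , ≃ᵏ-sym κ , Eq.sym ν)
      (λ d → let e , κ , ν = h d in e , ≃ᵏ-sym κ , Eq.sym ν)

    ≃ᵏ-sym : {k l : Key Γ} → k ≃ᵏ l → l ≃ᵏ k
    ≃ᵏ-sym atomic    = atomic
    ≃ᵏ-sym (stage h) = stage (≃-sym h)

  mutual
    ≃-trans : {F G H : Graph Γ} → F ≃ G → G ≃ H → F ≃ H
    ≃-trans (equal h k) (equal h′ k′) = equal
      (λ d → let e , κ , ν = h d ; f , κ′ , ν′ = h′ e in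
        f , ≃ᵏ-trans κ κ′ , Eq.trans ν ν′)
      (λ f → let e , κ′ , ν′ = k′ f ; d , κ , ν = k e in
        d , ≃ᵏ-trans κ κ′ , Eq.trans ν ν′)

    ≃ᵏ-trans : {k l m : Key Γ} → k ≃ᵏ l → l ≃ᵏ m → k ≃ᵏ m
    ≃ᵏ-trans atomic    atomic     = atomic
    ≃ᵏ-trans (stage h) (stage h′) = stage (≃-trans h h′)

  _⊆_ : Graph Γ → Graph Γ → Set _
  G ⊆ H = ∀ d → ∃ λ e → key G d ≃ᵏ key H e × val G d ≈ val H e

  ⊆-antisym : {G H : Graph Γ} → G ⊆ H → H ⊆ G → G ≃ H
  ⊆-antisym h k = equal h
    λ e → let d , κ , ν = k e in d , ≃ᵏ-sym κ , Eq.sym ν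

  Fᵃ : ∀ α → Acc W._<_ α → Point Γ → Graph Γ
  Fᵃ α p x = F-acc α p (str x) (tup x)

  F̂ : W.Carrier → Point Γ → Graph Γ
  F̂ α = Fᵃ α (W.wellFounded α)

  infixl 8 _↾ᵖ_
  _↾ᵖ_ : Point Γ → Carrier → Point Γ
  x ↾ᵖ q = point (str x) (_↾ᵗ_ (str x) (tup x) q)

  -- The value of F^(β+1) for `x` at the argument (F^β of `k ▸ t`, `β`).
  weightᵃ : ∀ β → Acc W._<_ β → ∀ {δ} (k : Point Γ) → (↓ δ → Section (str k)) →
            Point Γ → Carrier
  weightᵃ β p {δ} k t x =
    ⋁ {I = Σ (↓ δ → Section (str x)) λ c → Eᵗ (str x) c ≤ Eᵗ (str k) t ×
           Fᵃ β p ((k ▸ t) ↾ᵖ Eᵗ (str x) c) ≃ Fᵃ β p (x ▸ c)}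
      λ (c , _) → Eᵗ (str x) c

  weightᵃ-cong : ∀ (p q : Acc W._<_ β) {δ} (k : Point Γ)
                 (t : ↓ δ → Section (str k)) x →
                 (∀ {Δ} (x : Point Δ) → Fᵃ β p x ≃ Fᵃ β q x) →
                 weightᵃ β p k t x ≈ weightᵃ β q k t x
  weightᵃ-cong {β = β} p q k t x h =
    antisym (mono p q h) (mono q p λ y → ≃-sym (h y))
    where
    mono : ∀ p q → (∀ {Δ} (x : Point Δ) → Fᵃ β p x ≃ Fᵃ β q x) →
           weightᵃ β p k t x ≤ weightᵃ β q k t x
    mono p q h = ⋁-least _ _ λ (c , c≤t , eq) → ⋁-upper _
      (c , c≤t , ≃-trans (≃-sym (h _)) (≃-trans eq (h (x ▸ c))))

  -- `F` at the earlier stage occurs in the new keys and in the condition selecting the tuples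
  -- joined in a value; both call for `≃`, hence the mutual recursion.
  Fᵃ-⊆ : ∀ (p q : Acc W._<_ α) (x : Point Γ) → Fᵃ α p x ⊆ Fᵃ α q x
  Fᵃ-irr : ∀ (p q : Acc W._<_ α) (x : Point Γ) → Fᵃ α p x ≃ Fᵃ α q x

  Fᵃ-irr p q x = ⊆-antisym (Fᵃ-⊆ p q x) (Fᵃ-⊆ q p x)

  Fᵃ-⊆ {α} (acc rs) (acc rs′) x d with W.kind α
  Fᵃ-⊆ (acc rs) (acc rs′) x d | least _ = d , atomic , Eq.refl
  Fᵃ-⊆ (acc rs) (acc rs′) x (inj₁ d) | successor β β<α _ =
    let e , κν = Fᵃ-⊆ (rs β<α) (rs′ β<α) x d in inj₁ e , κν
  Fᵃ-⊆ (acc rs) (acc rs′) x (inj₂ (e , valid)) | successor β β<α _ =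
    inj₂ (e , valid) , stage (Fᵃ-irr (rs β<α) (rs′ β<α) (ext e)) ,
    weightᵃ-cong (rs β<α) (rs′ β<α) (point (Extension.K e) (Extension.s e))
      (Extension.t e) x (Fᵃ-irr (rs β<α) (rs′ β<α))
  Fᵃ-⊆ (acc rs) (acc rs′) x ((β , β<α) , d) | limit _ _ =
    let e , κν = Fᵃ-⊆ (rs β<α) (rs′ β<α) x d in ((β , β<α) , e) , κν

  -- Graphs as sets of entries.

  weight : W.Carrier → ∀ {δ} (k : Point Γ) → (↓ δ → Section (str k)) →
           Point Γ → Carrier
  weight β = weightᵃ β (W.wellFounded β)

  -- The graph of F^α, unrolled over all stages below α at once.
  data Entry (α : W.Carrier) {Γ : Set ℓ} (x : Point Γ) :
             Key Γ → Carrier → Set (suc (suc ℓ)) where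
    atomic : ∀ {n v} ψ (f : Vec Γ n) → (∀ j → j ∈ vars ψ) →
             v ≈ value x (rename (lookup f) ψ) → Entry α x (atomic n ψ f) v
    stage  : ∀ {β δ G v} → β W.< α → (k : Point Γ) (t : ↓ δ → Section (str k)) →
             Eᵗ (str k) t ≤ extent x ∧ extent k →
             G ≃ F̂ β (k ▸ t) → v ≈ weight β k t x → Entry α x (stage δ G β) v

  Entry-mono : β W.< α → ∀ {x : Point Γ} {k v} → Entry β x k v → Entry α x k v
  Entry-mono β<α (atomic ψ f cov ν)        = atomic ψ f cov ν
  Entry-mono β<α (stage γ<β k t e κ ν) = stage (W<.trans γ<β β<α) k t e κ ν

  Entry-resp : ∀ {x : Point Γ} {k l v w} → k ≃ᵏ l → v ≈ w →
               Entry α x k v → Entry α x l w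
  Entry-resp atomic    v≈w (atomic ψ f cov ν) = atomic ψ f cov (Eq.trans (Eq.sym v≈w) ν)
  Entry-resp (stage h) v≈w (stage β<α k t e κ ν) =
    stage β<α k t e (≃-trans (≃-sym h) κ) (Eq.trans (Eq.sym v≈w) ν)

  Entry-sound : ∀ (p : Acc W._<_ α) (x : Point Γ) d →
                Entry α x (key (Fᵃ α p x) d) (val (Fᵃ α p x) d)
  Entry-sound {α} (acc rs) x d with W.kind α
  Entry-sound (acc rs) x (lift (_ , ψ , cov , f)) | least _ = atomic ψ f cov Eq.refl
  Entry-sound (acc rs) x (inj₁ d) | successor β β<α _ =
    Entry-mono β<α (Entry-sound (rs β<α) x d)
  Entry-sound (acc rs) x (inj₂ (e , valid)) | successor β β<α _ =
    let irr = λ {Δ} → Fᵃ-irr {Γ = Δ} (rs β<α) (W.wellFounded β)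
        k   = point (Extension.K e) (Extension.s e)
    in stage β<α k (Extension.t e) valid (irr (ext e))
         (weightᵃ-cong (rs β<α) (W.wellFounded β) k (Extension.t e) x irr)
  Entry-sound (acc rs) x ((β , β<α) , d) | limit _ _ =
    Entry-mono β<α (Entry-sound (rs β<α) x d)

  -- At a successor, an entry tagged with the predecessor is a new argument and all others are
  -- inherited. Arguments tagged `β` first appear after `β`, so at a limit a stage between `β` and
  -- `α` is chosen.
  Entry-complete : ∀ (p : Acc W._<_ α) {x : Point Γ} {k v} → Entry α x k v →
                   ∃ λ d → k ≃ᵏ key (Fᵃ α p x) d × v ≈ val (Fᵃ α p x) d
  Entry-complete {α} (acc rs) e with W.kind α
  Entry-complete (acc rs) (atomic {n} ψ f cov ν) | least _ =
    lift (n , ψ , cov , f) , atomic , ν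
  Entry-complete (acc rs) (stage β<α _ _ _ _ _) | least ≮α = ⊥-elim (≮α _ β<α)
  Entry-complete (acc rs) (atomic ψ f cov ν) | successor β β<α _ =
    let d , κν = Entry-complete (rs β<α) (atomic ψ f cov ν) in inj₁ d , κν
  Entry-complete (acc rs) {x} (stage β<α k t valid κ ν) | successor γ γ<α below
    with below _ β<α
  ... | inj₂ β<γ =
    let d , κν = Entry-complete (rs γ<α) (stage β<γ k t valid κ ν) in inj₁ d , κν
  ... | inj₁ refl =
    let irr = λ {Δ} → Fᵃ-irr {Γ = Δ} (W.wellFounded γ) (rs γ<α)
    in inj₂ (record { K = str k ; s = tup k ; t = t } , valid) ,
       stage (≃-trans κ (irr (k ▸ t))) ,
       Eq.trans ν (weightᵃ-cong (W.wellFounded γ) (rs γ<α) k t x irr)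
  Entry-complete (acc rs) (atomic ψ f cov ν) | limit (β , β<α) _ =
    let d , κν = Entry-complete (rs β<α) (atomic ψ f cov ν) in ((β , β<α) , d) , κν
  Entry-complete (acc rs) (stage β<α k t valid κ ν) | limit _ dense =
    let γ , β<γ , γ<α = dense _ β<α
        d , κν = Entry-complete (rs γ<α) (stage β<γ k t valid κ ν)
    in ((γ , γ<α) , d) , κν

  -- Inclusion of graphs.

  Sim : W.Carrier → Point Γ → Point Γ → Set _
  Sim α x y = ∀ {k v} → Entry α x k v → Entry α y k v

  -- `Entry` is closed under `≃ᵏ` and `≈`, so equality of graphs amounts to two plain inclusions,
  -- which can then be used one at a time.
  ≃⇒Sim : ∀ (x y : Point Γ) → F̂ α x ≃ F̂ α y → Sim α x y
  ≃⇒Sim {α = α} x y (equal h _) entry =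
    let d , κ , ν   = Entry-complete (W.wellFounded α) entry
        e , κ′ , ν′ = h d
    in Entry-resp (≃ᵏ-sym (≃ᵏ-trans κ κ′)) (Eq.sym (Eq.trans ν ν′))
         (Entry-sound (W.wellFounded α) y e)

  Sim⇒≃ : ∀ (x y : Point Γ) → Sim α x y → Sim α y x → F̂ α x ≃ F̂ α y
  Sim⇒≃ {α = α} x y h k = ⊆-antisym (λ d → complete (h (sound x d)))
                                    (λ d → complete (k (sound y d)))
    where
    sound : ∀ x d → Entry α x (key (F̂ α x) d) (val (F̂ α x) d)
    sound = Entry-sound (W.wellFounded α)

    complete : ∀ {x k v} → Entry α x k v →
               ∃ λ d → k ≃ᵏ key (F̂ α x) d × v ≈ val (F̂ α x) d
    complete = Entry-complete (W.wellFounded α)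

  -- The stage is part of the key, so the matching entry carries the same stage, already below `β`.
  Sim-restrict : ∀ {x y : Point Γ} → β W.< α → Sim α x y → Sim β x y
  Sim-restrict β<α h (atomic ψ f cov ν) with h (atomic ψ f cov ν)
  ... | atomic ψ f cov′ ν′ = atomic ψ f cov′ ν′
  Sim-restrict β<α h (stage γ<β k t valid κ ν)
    with h (stage (W<.trans γ<β β<α) k t valid κ ν)
  ... | stage _ k′ t′ valid′ κ′ ν′ = stage γ<β k′ t′ valid′ κ′ ν′

  Sim-value : ∀ {x y : Point Γ} → Sim α x y → ∀ ψ → value x ψ ≈ value y ψ
  Sim-value {x = x} {y} h ψ with normalise ψ
  ... | normal form cov assign renames with h (atomic form assign cov Eq.refl)
  ...   | atomic _ _ _ ν = subst (λ χ → value x χ ≈ value y χ) renames ν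

  Sim-extent : ∀ {x y : Point Γ} → Sim α x y → extent x ≤ extent y
  Sim-extent {x = x} h = ⋀-greatest λ i → ≤-trans
    (∧-greatest ≤-refl (≤-trans (⋀-lower i) (P.≐-refl (str x) (S.refl (str x)))))
    (≤-trans (reflexive (Sim-value h (var≐var i i))) (∧-weaken₁ (⋀-lower i)))

  -- Only a nonempty tuple can be given a smaller extent by restriction, so witnesses are treated
  -- according to whether they are empty.
  ↓-inhabited? : ∀ δ → (↓ δ) ⊎ ¬ (↓ δ)
  ↓-inhabited? δ with Ordinal.kind (μ 𝓛) δ
  ... | least ≮δ                = inj₂ λ (γ , [ γ<δ ]) → ⊥-elim-irr (≮δ γ γ<δ)
  ... | successor γ γ<δ _       = inj₁ (γ , [ γ<δ ])
  ... | limit (γ , γ<δ) _       = inj₁ (γ , [ γ<δ ])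

  ⊎-identityʳ : ∀ {A B : Set ℓ} → ¬ B → A ↔ (A ⊎ B)
  ⊎-identityʳ ¬b = mk↔ₛ′ inj₁ (λ { (inj₁ a) → a ; (inj₂ b) → ⊥-elim (¬b b) })
    (λ { (inj₁ a) → refl ; (inj₂ b) → ⊥-elim (¬b b) }) (λ _ → refl)

  -- The induction on stages.

  D-refl : ∀ {x : Point Γ} → extent x ≤ D α x x
  D-refl {x = x} = D-local λ i →
    ≤-trans (⋀-lower i) (P.≐-refl (str x) (S.refl (str x)))

  D-↾ : ∀ {x : Point Γ} {q} → u ≤ extent x → u ≤ q → u ≤ D α x (x ↾ᵖ q)
  D-↾ {x = x} h k = D-local (P.≐-↾ᵗ (str x) h k)

  D-▸ : ∀ {δ} {x : Point Γ} {c c′ : ↓ δ → Section (str x)} → u ≤ extent x →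
        (∀ j → u ≤ ⟦ str x ≐ c j ⟧ (c′ j)) → u ≤ D α (x ▸ c) (x ▸ c′)
  D-▸ {x = x} h k = D-local
    λ { (inj₁ i) → ≤-trans h (≤-trans (⋀-lower i) (P.≐-refl (str x) (S.refl (str x))))
      ; (inj₂ j) → k j }

  -- The induction statement, for tuples of every length because stages below concern longer tuples.
  -- Equality of extents is derived from equality of graphs, not assumed.
  Correct : W.Carrier → Set _
  Correct β = ∀ {Γ} (x y : Point Γ) →
    F̂ β x ≃ F̂ β y ⇔ (extent x ≈ extent y × extent x ≤ D β x y)

  -- Single sections of `x` may have extents beyond `q`, so the tuple itself can change; it does not
  -- change on its common extent, which is all that `F` sees.
  F̂-↾ : Correct β → ∀ (x : Point Γ) {q} → extent x ≤ q → F̂ β (x ↾ᵖ q) ≃ F̂ β x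
  F̂-↾ {β = β} correct x {q} h = Equivalence.from (correct (x ↾ᵖ q) x)
    ( antisym (P.Eᵗ-↾ᵗ-mono (str x)) E≤
    , ≤-trans (P.Eᵗ-↾ᵗ-mono (str x)) (≤-trans (D-↾ ≤-refl h) D-sym) )
    where
    E≤ : extent x ≤ extent (x ↾ᵖ q)
    E≤ = P.Eᵗ-↾ᵗ-≥ (str x) ≤-refl h

  -- A tuple `c` counted for `x` witnesses `φ` of `x ▸ c` on its extent `r`. There `y` satisfies the
  -- same existential formula, and its witnesses, restricted, are counted for `y` and cover `r`.
  D⇒weight : ∀ {x y : Point Γ} → Correct β → extent x ≤ extent y →
             (∀ e → extent x ≤ ∃ᴰ β e x ⇿ ∃ᴰ β e y) →
             ∀ {δ} (k : Point Γ) (t : ↓ δ → Section (str k)) →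
             Eᵗ (str k) t ≤ extent x ∧ extent k →
             weight β k t x ≤ weight β k t y
  D⇒weight {β = β} {x} {y} correct Ex≤Ey h {δ} k t valid =
    ⋁-least _ _ λ (c , c≤t , eq) → bound c c≤t eq
    where
    bound : ∀ c → Eᵗ (str x) c ≤ Eᵗ (str k) t →
            F̂ β ((k ▸ t) ↾ᵖ Eᵗ (str x) c) ≃ F̂ β (x ▸ c) →
            Eᵗ (str x) c ≤ weight β k t y
    bound c c≤t eq = ≤-trans (∧-greatest ≤-refl r≤∃) pick
      where
      r = Eᵗ (str x) c

      r≤x : r ≤ extent x
      r≤x = ≤-trans c≤t (≤-trans valid (x∧y≤x _ _))

      r≤kt : r ≤ extent (k ▸ t)
      r≤kt = Eᵗ-⌢ (str k) (≤-trans c≤t (≤-trans valid (x∧y≤y _ _))) c≤t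

      r≤D : r ≤ D β (k ▸ t) (x ▸ c)
      r≤D = D-trans (D-↾ r≤kt ≤-refl)
        (≤-trans (P.Eᵗ-↾ᵗ-≥ (str k) r≤kt ≤-refl)
          (proj₂ (Equivalence.to (correct _ (x ▸ c)) eq)))

      e : Extension _
      e = record { K = str x ; s = tup x ; t = c }

      r≤∃ : r ≤ ∃ᴰ β e y
      r≤∃ = ⇿-mp (≤-trans r≤x (h e))
        (∃ᴰ-intro c (≤-trans (Eᵗ-⌢ (str x) r≤x ≤-refl) D-refl))

      contribute : ∀ d → Eᵗ (str y) d ≤ r → Eᵗ (str y) d ≤ D β (x ▸ c) (y ▸ d) →
                   Eᵗ (str y) d ≤ weight β k t y
      contribute d d≤r d≤D = ⋁-upper _
        (d , ≤-trans d≤r c≤t , Equivalence.from (correct _ (y ▸ d))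
          ( antisym
              (Eᵗ-⌢ (str y) (≤-trans kt↾≤d (≤-trans d≤r (≤-trans r≤x Ex≤Ey))) kt↾≤d)
              (≤-trans (Eᵗ-⌢ʳ (str y))
                (P.Eᵗ-↾ᵗ-≥ (str k) (≤-trans d≤r r≤kt) ≤-refl))
          , ≤-trans kt↾≤d (D-trans (≤-trans (D-↾ (≤-trans d≤r r≤kt) ≤-refl) D-sym)
              (D-trans (≤-trans d≤r r≤D) d≤D)) ))
        where
        kt↾≤d : extent ((k ▸ t) ↾ᵖ Eᵗ (str y) d) ≤ Eᵗ (str y) d
        -- Each `j` also provides the index needed to bound a restriction; if there is none, the
        -- right side is the empty meet.
        kt↾≤d = ⋀-greatest λ j → ≤-trans (P.Eᵗ-↾ᵗ-≤ (str k) _ (inj₂ j)) (⋀-lower j)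

      pick : r ∧ ∃ᴰ β e y ≤ weight β k t y
      pick with ↓-inhabited? δ
      ... | inj₁ j = ∃ᴰ-elim λ d →
        let q  = r ∧ D β (x ▸ c) (y ▸ d)
            d′ = _↾ᵗ_ (str y) d q
            q≤d : q ≤ Eᵗ (str y) d
            q≤d = ∧-weaken₂ (≤-trans D-extent (Eᵗ-⌢ʳ (str y)))
            d′≤q : Eᵗ (str y) d′ ≤ q
            d′≤q = P.Eᵗ-↾ᵗ-≤ (str y) q j
            q≤y : q ≤ extent y
            q≤y = ∧-weaken₂ (≤-trans D-extent (Eᵗ-⌢ˡ (str y)))
        in ≤-trans (P.Eᵗ-↾ᵗ-≥ (str y) q≤d ≤-refl)
             (contribute d′ (≤-trans d′≤q (x∧y≤x _ _))
               (≤-trans d′≤q (D-trans (x∧y≤y _ _)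
                 (D-▸ q≤y (P.≐-↾ᵗ (str y) q≤d ≤-refl)))))
      -- Here `r` is an empty meet, so every element lies below `∃ᴰ β e y`, and any witness `d′` for
      -- it is vacuously equal to `d`.
      ... | inj₂ empty = ≤-trans (top (str y) d) (contribute d (top (str x) c)
        (≤-trans (∧-greatest (top (str x) c) (≤-trans (top (str x) c) r≤∃))
          (∃ᴰ-elim λ d′ → D-trans (x∧y≤y _ _)
            (D-▸ (∧-weaken₂ (≤-trans D-extent (Eᵗ-⌢ˡ (str y)))) (⊥-elim ∘ empty)))))
        where
        d : ↓ δ → Section (str y)
        d = ⊥-elim ∘ empty

        top : ∀ (M : Structure Ω σ) (c : ↓ δ → Section M) → v ≤ Eᵗ M c
        top M c = ⋀-greatest (⊥-elim ∘ empty)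

  -- `φ` quantifies over all extensions, `F` only over those with small enough extent. So a witness
  -- `c` for `e` is restricted to the truth value `q` it achieves, and `x ▸ c↾` serves as the
  -- argument of `F`; its value is at least `q`, and tuples counted for `y` there are witnesses for
  -- `e`.
  Sim⇒∃ : ∀ {x y : Point Γ} → Correct β → β W.< α → Sim α x y →
          extent x ≤ D β x y → ∀ e → extent x ∧ ∃ᴰ β e x ≤ ∃ᴰ β e y
  Sim⇒∃ {β = β} {x = x} {y} correct β<α h Ex≤D e =
    ∃ᴰ-elim λ c → ≤-trans (x∧y≤y _ _) (bound c)
    where
    open Extension e using (δ)

    bound : ∀ c → D β (ext e) (x ▸ c) ≤ ∃ᴰ β e y
    bound c with ↓-inhabited? δ
    -- An empty `c` gives an argument of `F` only if `extent x` is `⊤`. Instead `Ex≤D` is carried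
    -- along `Γ ↔ (Γ ⊎ (↓ δ))`.
    ... | inj₂ empty = ∃ᴰ-intro (⊥-elim ∘ empty) (D-trans ≤-refl
      (≤-trans D-extent (≤-trans (Eᵗ-⌢ˡ (str x)) (≤-trans Ex≤D
        (D-reindex (str x) (str y) (⊎-identityʳ empty)
          (λ _ → S.refl (str x)) (λ _ → S.refl (str y)))))))
    ... | inj₁ j = go (h (stage β<α x c↾ valid (Sim⇒≃ _ _ id id) Eq.refl))
      where
      q = D β (ext e) (x ▸ c)

      c↾ : ↓ δ → Section (str x)
      c↾ = _↾ᵗ_ (str x) c q

      q≤c : q ≤ Eᵗ (str x) c
      q≤c = ≤-trans D-extent (Eᵗ-⌢ʳ (str x))

      q≤x : q ≤ extent x
      q≤x = ≤-trans D-extent (Eᵗ-⌢ˡ (str x))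

      c↾≤q : Eᵗ (str x) c↾ ≤ q
      c↾≤q = P.Eᵗ-↾ᵗ-≤ (str x) q j

      q≤c↾ : q ≤ Eᵗ (str x) c↾
      q≤c↾ = P.Eᵗ-↾ᵗ-≥ (str x) q≤c ≤-refl

      valid : Eᵗ (str x) c↾ ≤ extent x ∧ extent x
      valid = ≤-trans c↾≤q (∧-greatest q≤x q≤x)

      q≤weight : q ≤ weight β x c↾ x
      q≤weight = ≤-trans q≤c↾ (⋁-upper _
        (c↾ , ≤-refl , F̂-↾ correct (x ▸ c↾) (Eᵗ-⌢ʳ (str x))))

      go : Entry _ y (stage δ (F̂ β (x ▸ c↾)) β) (weight β x c↾ x) → q ≤ ∃ᴰ β e y
      -- The key fixes its tuple only up to `≃`, so `k ▸ t` may differ from `x ▸ c↾`; `correct`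
      -- turns `κ` into a bound on `D`.
      go (stage _ k t valid′ κ ν) = ≤-trans q≤weight (≤-trans (reflexive ν)
        (⋁-least _ _ λ (d , d≤t , eq) → ∃ᴰ-intro d (chain d d≤t eq)))
        where
        E≈×≤D : extent (x ▸ c↾) ≈ extent (k ▸ t) ×
                extent (x ▸ c↾) ≤ D β (x ▸ c↾) (k ▸ t)
        E≈×≤D = Equivalence.to (correct (x ▸ c↾) (k ▸ t)) κ

        chain : ∀ d → Eᵗ (str y) d ≤ Eᵗ (str k) t →
                F̂ β ((k ▸ t) ↾ᵖ Eᵗ (str y) d) ≃ F̂ β (y ▸ d) →
                Eᵗ (str y) d ≤ D β (ext e) (y ▸ d)
        chain d d≤t eq =
          -- The chain runs from `ext e` through `x ▸ c`, `x ▸ c↾`, `k ▸ t` and the restriction of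
          -- `k ▸ t` to `y ▸ d`.
          D-trans d≤q (D-trans
            (≤-trans d≤q (D-▸ q≤x (P.≐-↾ᵗ (str x) q≤c ≤-refl)))
            (D-trans (≤-trans d≤xc↾ (proj₂ E≈×≤D))
              (D-trans (D-↾ d≤kt ≤-refl)
                (≤-trans (P.Eᵗ-↾ᵗ-≥ (str k) d≤kt ≤-refl)
                  (proj₂ (Equivalence.to (correct _ (y ▸ d)) eq))))))
          where
          d≤kt : Eᵗ (str y) d ≤ extent (k ▸ t)
          d≤kt = Eᵗ-⌢ (str k) (≤-trans d≤t (≤-trans valid′ (x∧y≤y _ _))) d≤t

          d≤xc↾ : Eᵗ (str y) d ≤ extent (x ▸ c↾)
          d≤xc↾ = ≤-trans d≤kt (reflexive (Eq.sym (proj₁ E≈×≤D)))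

          d≤q : Eᵗ (str y) d ≤ q
          d≤q = ≤-trans d≤xc↾ (≤-trans (Eᵗ-⌢ʳ (str x)) c↾≤q)

  D⇒Sim : ∀ {x y : Point Γ} → (∀ {β} → β W.< α → Correct β) →
          extent x ≈ extent y → extent x ≤ D α x y → Sim α x y
  D⇒Sim {α = α} {x} {y} correct Ex≈Ey Ex≤D = sim
    where
    Ey≤D : extent y ≤ D α y x
    Ey≤D = ≤-trans (reflexive (Eq.sym Ex≈Ey)) (≤-trans Ex≤D D-sym)

    value≤ : ∀ {x y : Point _} ψ → extent x ≤ D α x y → value x ψ ≤ value y ψ
    value≤ ψ E≤D = ⇿-mp (≤-trans (x∧y≤x _ _) (≤-trans E≤D (D-atom ψ))) ≤-refl

    sim : Sim α x y
    sim (atomic ψ f cov ν) = atomic ψ f cov (Eq.trans ν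
      (antisym (value≤ (rename (lookup f) ψ) Ex≤D) (value≤ (rename (lookup f) ψ) Ey≤D)))
    sim (stage β<α k t valid κ ν) = stage β<α k t valid′ κ (Eq.trans ν (antisym
      (D⇒weight (correct β<α) (reflexive Ex≈Ey)
        (λ e → ≤-trans Ex≤D (D-∃ β<α e)) k t valid)
      (D⇒weight (correct β<α) (reflexive (Eq.sym Ex≈Ey))
        (λ e → ≤-trans Ey≤D (D-∃ β<α e)) k t valid′)))
      where
      valid′ = ≤-trans valid
        (∧-greatest (≤-trans (x∧y≤x _ _) (reflexive Ex≈Ey)) (x∧y≤y _ _))

  -- `Sim⇒∃` at `β` presupposes the conclusion at `β`, which comes from recursion on the inclusions
  -- restricted to `β`.
  Sim⇒D : ∀ {x y : Point Γ} → Acc W._<_ α → (∀ {β} → β W.< α → Correct β) →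
          Sim α x y → Sim α y x → extent x ≤ D α x y
  Sim⇒D {x = x} {y} (acc rs) correct h k = D-greatest (Sim-extent h)
    (λ ψ → ⇿-intro (∧-weaken₂ (reflexive (Sim-value h ψ)))
                   (∧-weaken₂ (reflexive (Sim-value k ψ))))
    λ {β} β<α e →
      let correct′ : ∀ {γ} → γ W.< β → Correct γ
          correct′ γ<β = correct (W<.trans γ<β β<α)
          h′ = Sim-restrict β<α h
          k′ = Sim-restrict β<α k
      in ⇿-intro
        (Sim⇒∃ (correct β<α) β<α h (Sim⇒D (rs β<α) correct′ h′ k′) e)
        (≤-trans (∧-greatest (∧-weaken₁ (Sim-extent h)) (x∧y≤y _ _))
          (Sim⇒∃ (correct β<α) β<α k (Sim⇒D (rs β<α) correct′ k′ h′) e))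

  correct : Acc W._<_ α → Correct α
  correct {α} (acc rs) x y = mk⇔
    (λ eq → let h = ≃⇒Sim x y eq ; k = ≃⇒Sim y x (≃-sym eq) in
      antisym (Sim-extent h) (Sim-extent k) ,
      Sim⇒D (acc rs) (λ β<α → correct (rs β<α)) h k)
    (λ (Ex≈Ey , Ex≤D) → Sim⇒≃ x y
      (D⇒Sim (λ β<α → correct (rs β<α)) Ex≈Ey Ex≤D)
      (D⇒Sim (λ β<α → correct (rs β<α)) (Eq.sym Ex≈Ey)
        (≤-trans (reflexive (Eq.sym Ex≈Ey)) (≤-trans Ex≤D D-sym))))

corollary12p3 :
    ∀ {ℓ} (Ω : CompleteHeytingAlgebra ℓ) (σ : Signature ℓ) (𝓛 : Logic ℓ)
    (M N : Structure Ω σ) (γ : Ordinal ℓ)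
    (a : Ordinal.Carrier γ → Structure.Section M)
    (b : Ordinal.Carrier γ → Structure.Section N) →
    CompleteHeytingAlgebra._≈_ Ω (Structure.Eᵗ N b) (Structure.Eᵗ M a) →
    (W : Ordinal ℓ) (α : Ordinal.Carrier W) →
    let open CompleteHeytingAlgebra Ω using (_≈_)
        open Formulae Ω σ 𝓛 using (Value)
        open Invariants Ω σ 𝓛 W
    in
    (Value N (φ α M a) b ≈ Value N (φ α N b) b) ⇔ (F α M a ≃ F α N b)
corollary12p3 Ω σ 𝓛 M N γ a b Eb≈Ea W α = mk⇔
  -- `D α y y` equals `extent y` by `D-extent` and `D-refl`, so (1) says that `extent y ≤ D α x y`.
  (λ eq → E.from (Eq.sym Eb≈Ea , ≤-trans (reflexive (Eq.sym Eb≈Ea))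
    (≤-trans D-refl (reflexive (Eq.sym (D-≈.from eq))))))
  (λ eq → D-≈.to (antisym (≤-trans D-extent D-refl)
    (≤-trans D-extent (≤-trans (reflexive Eb≈Ea) (proj₂ (E.to eq))))))
  where
  open CompleteHeytingAlgebra Ω renaming (trans to ≤-trans)
  open Characterisation Ω σ 𝓛 W
  x = point M a
  y = point N b
  module E   = Equivalence (correct (Ordinal.wellFounded W α) x y)
  module D-≈ = Equivalence (D-≈⇔Value-≈ {α = α} {x = x} {y})
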